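{- Let $k\geq 1$ be an integer. For every graph $G$ with minimum degree $\delta(G)\geq k$ and maximum degree $\Delta(G)$, $$\gamma^{t}_{kS}(G) \geq |V(G)|\cdot\frac{\delta(G)-\Delta(G)+2k+2-I_{\delta(G)}-I_{\Delta(G)}}{\delta(G)+\Delta(G)+I_{\Delta(G)}-I_{\delta(G)}}\;.$$
   Context: All graphs are finite, simple and undirected, with nonempty vertex set. For each integer $n$, $I_n=1$ if $n\equiv k\pmod 2$, and $I_n=0$ otherwise. For a vertex $v$ of $G$, $N_G(v)$ denotes the open neighborhood of $v$ (the set of vertices adjacent to $v$). For $G$ of minimum degree at least $k$, a function $f:V(G)\rightarrow\{ -1,1\}$ is a signed total $k$-dominating function of $G$ if $\sum_{u\in N_G(v)}f(u)\geq k$ for all $v\in V(G)$. The signed total $k$-domination number $\gamma^{t}_{kS}(G)$ is the minimum of $\sum_{v\in V(G)}f(v)$ over all signed total $k$-dominating functions $f$ of $G$. -}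

module Defs where

open import Data.Bool.Base using (true; false; if_then_else_)
open import Data.Fin.Base using (Fin; zero; suc; fromℕ<)
import Data.Fin.Properties as Fin
open import Data.Integer.Base as ℤ using (ℤ; 0ℤ; 1ℤ; -1ℤ; +_)
import Data.Integer.Properties as ℤ
import Data.List.Extrema ℤ.≤-totalOrder as ℤmin
open import Data.List.Extrema.Nat using (min; max; min≤xs; xs≤max; argmin-sel; argmax-sel)
open import Data.List.Base using (List; []; _∷_; [_]; length; map; foldr; filter; allFin; cartesianProductWith)
open import Data.List.Membership.Propositional using (_∈_; lose)
open import Data.List.Membership.Propositional.Properties
  using (∈-allFin; ∈-map⁺; ∈-map⁻; ∈-filter⁺; ∈-cartesianProductWith⁺)
open import Data.List.Properties using (map-cong)
open import Data.List.Relation.Unary.All as All using (All)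
open import Data.List.Relation.Unary.All.Properties using (all-filter)
open import Data.List.Relation.Unary.Any using (here; there)
open import Data.Nat.Base as ℕ using (ℕ; zero; suc; NonZero; _≤_; _%_; z≤n; s≤s)
import Data.Nat.Properties as ℕ
open import Data.Product.Base using (∃; _×_; _,_)
open import Data.Sign.Base using (Sign) renaming (+ to ⊕; - to ⊖)
open import Data.Sum.Base using (inj₁; inj₂)
open import Data.Vec.Functional as Vector using (Vector)
open import Function.Base using (id; _∘_; const)
open import Level using (0ℓ)
open import Relation.Binary.Core using (Rel)
open import Relation.Binary.Definitions using (Decidable; Irreflexive; Symmetric)
open import Relation.Binary.PropositionalEquality
  using (_≡_; refl; sym; cong; subst; _≗_)
open import Relation.Nullary.Decidable using (Dec; does)

-- The vertices are labelled by Fin order, which loses no generality for finite graphs.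
record Graph : Set₁ where
  field
    order      : ℕ
    {{order≢0}} : NonZero order
    _~_        : Rel (Fin order) 0ℓ
    _~?_       : Decidable _~_
    ~-sym      : Symmetric _~_
    ~-irrefl   : Irreflexive _≡_ _~_

  Vertex : Set
  Vertex = Fin order

  vertices : List Vertex
  vertices = allFin order

  vertex₀ : Vertex
  vertex₀ = fromℕ< (ℕ.>-nonZero⁻¹ order)

  N : Vertex → List Vertex
  N v = filter (v ~?_) vertices

  degree : Vertex → ℕ
  degree v = length (N v)

  -- The first argument of min and max only seeds the fold; it is itself a degree.
  δ Δ : ℕ
  δ = min (degree vertex₀) (map degree vertices)
  Δ = max (degree vertex₀) (map degree vertices)

  δ-least : ∀ v → δ ≤ degree v
  δ-least v = All.lookup (min≤xs _ (map degree vertices)) (∈-map⁺ degree (∈-allFin v))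

  δ-attained : ∃ λ v → δ ≡ degree v
  δ-attained with argmin-sel id (degree vertex₀) (map degree vertices)
  ... | inj₁ eq = vertex₀ , eq
  ... | inj₂ δ∈ with ∈-map⁻ degree δ∈
  ...   | v , _ , eq = v , eq

  Δ-greatest : ∀ v → degree v ≤ Δ
  Δ-greatest v = All.lookup (xs≤max _ (map degree vertices)) (∈-map⁺ degree (∈-allFin v))

  Δ-attained : ∃ λ v → Δ ≡ degree v
  Δ-attained with argmax-sel id (degree vertex₀) (map degree vertices)
  ... | inj₁ eq = vertex₀ , eq
  ... | inj₂ Δ∈ with ∈-map⁻ degree Δ∈
  ...   | v , _ , eq = v , eq

  δ≤Δ : δ ≤ Δ
  δ≤Δ = ℕ.≤-trans (δ-least vertex₀) (Δ-greatest vertex₀)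

open Graph public using (order; δ; Δ; δ≤Δ)

∑ : {A : Set} → List A → (A → ℤ) → ℤ
∑ xs f = foldr ℤ._+_ 0ℤ (map f xs)

-- The two-element set {-1, 1} is Sign, included in ℤ by ⟦_⟧.
⟦_⟧ : Sign → ℤ
⟦ ⊖ ⟧ = -1ℤ
⟦ ⊕ ⟧ = 1ℤ

allSignings : ∀ n → List (Vector Sign n)
allSignings zero    = [ (λ ()) ]
allSignings (suc n) = cartesianProductWith Vector._∷_ (⊖ ∷ ⊕ ∷ []) (allSignings n)

allSignings-complete : ∀ n (f : Vector Sign n) → ∃ λ g → g ∈ allSignings n × g ≗ f
allSignings-complete zero    f = (λ ()) , here refl , λ ()
allSignings-complete (suc n) f with allSignings-complete n (f ∘ suc)
... | g , g∈ , g≗f = f zero Vector.∷ g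
                   , ∈-cartesianProductWith⁺ Vector._∷_ (sign∈ (f zero)) g∈
                   , λ { zero → refl ; (suc i) → g≗f i }
  where
  sign∈ : ∀ s → s ∈ ⊖ ∷ ⊕ ∷ []
  sign∈ ⊖ = here refl
  sign∈ ⊕ = there (here refl)

weight : (G : Graph) → (Graph.Vertex G → Sign) → ℤ
weight G f = ∑ (Graph.vertices G) (⟦_⟧ ∘ f)

module _ (k : ℕ) (G : Graph) where
  open Graph G hiding (order; δ; Δ; δ≤Δ)

  SignedTotalDominating : (Vertex → Sign) → Set
  SignedTotalDominating f = ∀ v → + k ℤ.≤ ∑ (N v) (⟦_⟧ ∘ f)

  signedTotalDominating? : ∀ f → Dec (SignedTotalDominating f)
  signedTotalDominating? f = Fin.all? λ v → + k ℤ.≤? ∑ (N v) (⟦_⟧ ∘ f)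

  -- The seed const ⊕ is itself dominating as soon as k ≤ δ G.
  γᵗₛ : ℤ
  γᵗₛ = weight G (ℤmin.argmin (weight G) (const ⊕)
                 (filter signedTotalDominating? (allSignings (order G))))

  private
    ∑-cong : ∀ {f g : Vertex → Sign} → f ≗ g →
             ∀ xs → ∑ xs (⟦_⟧ ∘ f) ≡ ∑ xs (⟦_⟧ ∘ g)
    ∑-cong f≗g xs = cong (foldr ℤ._+_ 0ℤ) (map-cong (cong ⟦_⟧ ∘ f≗g) xs)

    ∑-ones : {A : Set} (xs : List A) → ∑ xs (const 1ℤ) ≡ + length xs
    ∑-ones []       = refl
    ∑-ones (x ∷ xs) = cong (λ s → 1ℤ ℤ.+ s) (∑-ones xs)

  γᵗₛ-least : ∀ f → SignedTotalDominating f → γᵗₛ ℤ.≤ weight G f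
  γᵗₛ-least f dom with allSignings-complete (order G) f
  ... | g , g∈ , g≗f = ℤmin.f[argmin]≤v⁺ _ _ (inj₂ (lose g∈′ (ℤ.≤-reflexive (∑-cong g≗f vertices))))
    where
    g∈′ : g ∈ filter signedTotalDominating? (allSignings (order G))
    g∈′ = ∈-filter⁺ signedTotalDominating? g∈
            (λ v → subst (+ k ℤ.≤_) (sym (∑-cong g≗f (N v))) (dom v))

  γᵗₛ-attained : k ≤ δ G → ∃ λ f → SignedTotalDominating f × γᵗₛ ≡ weight G f
  γᵗₛ-attained k≤δ = _ , ℤmin.argmin-all (weight G) ones
                             (all-filter signedTotalDominating? (allSignings (order G))) , refl
    where
    ones : SignedTotalDominating (const ⊕)
    ones v = subst (+ k ℤ.≤_) (sym (∑-ones (N v)))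
               (ℤ.+≤+ (ℕ.≤-trans k≤δ (δ-least v)))

I : (k n : ℕ) → ℕ
I k n = if does (n % 2 ℕ.≟ k % 2) then 1 else 0

I≤1 : ∀ k n → I k n ≤ 1
I≤1 k n with does (n % 2 ℕ.≟ k % 2)
... | true  = s≤s z≤n
... | false = z≤n

-- The truncated subtraction is exact: I k (δ G) ≤ 1 ≤ δ G wherever denominator is used.
denominator : ℕ → Graph → ℕ
denominator k G = (δ G ℕ.+ Δ G ℕ.+ I k (Δ G)) ℕ.∸ I k (δ G)

denominator≢0 : ∀ {k} → 1 ≤ k → ∀ G → k ≤ δ G → NonZero (denominator k G)
denominator≢0 {k} 1≤k G k≤δ = ℕ.>-nonZero (ℕ.m<n⇒0<n∸m (begin-strict
  I k (δ G)                      ≤⟨ I≤1 k (δ G) ⟩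
  1                              <⟨ ℕ.+-mono-≤ 1≤δ (ℕ.≤-trans 1≤δ (δ≤Δ G)) ⟩
  δ G ℕ.+ Δ G                    ≤⟨ ℕ.m≤m+n _ _ ⟩
  δ G ℕ.+ Δ G ℕ.+ I k (Δ G)      ∎))
  where
  open ℕ.≤-Reasoning
  1≤δ : 1 ≤ δ G
  1≤δ = ℕ.≤-trans 1≤k k≤δ

numerator : ℕ → Graph → ℤ
numerator k G = + δ G ℤ.- + Δ G ℤ.+ + 2 ℤ.* + k ℤ.+ + 2 ℤ.- + I k (δ G) ℤ.- + I k (Δ G)

{-# OPTIONS --safe #-}

-- Let f attain γᵗₛ, put σ v = ⟦ f v ⟧ and S v = ∑ (N v) σ. As S v ≡ degree v (mod 2), domination
-- improves to S v ≥ k + 1 - I (degree v). With p / q the fraction of the theorem, this gives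
--   2 σ v degree v + p ≤ 2 S v + q σ v
-- at every vertex v, and summing over v proves n p ≤ q (weight f), because
-- ∑ S v = ∑ σ v degree v by double counting.
module Submission where

open import Defs
open import Data.Bool.Base using (Bool; true; false; if_then_else_)
open import Data.Nat.Base using (ℕ; _≤_)
open import Data.Integer.Base using (+_)
open import Data.Rational.Base using (_/_; _*_; _≥_)

open import Data.Integer.Base as ℤ using (ℤ; 0ℤ; 1ℤ; -1ℤ)
import Data.Integer.Properties as ℤ
open import Data.Integer.Tactic.RingSolver using (solve-∀)
open import Data.List.Base using (List; []; _∷_; length; filter)
open import Data.List.Properties using (length-tabulate)
open import Data.Nat.Base as ℕ using (suc; NonZero; _%_)
open import Data.Nat.DivMod using ([m+kn]%n≡m%n)
import Data.Nat.Properties as ℕ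
open import Data.Product.Base using (∃; _,_)
import Data.Rational.Base as ℚ
import Data.Rational.Properties as ℚ
import Data.Rational.Unnormalised.Base as ℚᵘ
import Data.Rational.Unnormalised.Properties as ℚᵘ
open import Data.Sign.Base using (Sign) renaming (+ to ⊕; - to ⊖)
open import Data.Sum.Base using (inj₁; inj₂)
open import Function.Base using (_∘_; const; id)
open import Function.Bundles using (mk⇔)
open import Level using (0ℓ)
open import Relation.Binary.PropositionalEquality
  using (_≡_; refl; sym; trans; cong; cong₂; subst; subst₂; module ≡-Reasoning)
open import Relation.Nullary.Decidable using (yes; no; does; does-⇔; dec-true)
open import Relation.Unary using (Pred; Decidable)

private variable
  A B : Set

∑-cong : ∀ (xs : List A) {f g : A → ℤ} → (∀ x → f x ≡ g x) → ∑ xs f ≡ ∑ xs g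
∑-cong []       f≡g = refl
∑-cong (x ∷ xs) f≡g = cong₂ ℤ._+_ (f≡g x) (∑-cong xs f≡g)

∑-mono-≤ : ∀ (xs : List A) {f g : A → ℤ} → (∀ x → f x ℤ.≤ g x) → ∑ xs f ℤ.≤ ∑ xs g
∑-mono-≤ []       f≤g = ℤ.≤-refl
∑-mono-≤ (x ∷ xs) f≤g = ℤ.+-mono-≤ (f≤g x) (∑-mono-≤ xs f≤g)

∑-+ : ∀ (xs : List A) (f g : A → ℤ) → ∑ xs (λ x → f x ℤ.+ g x) ≡ ∑ xs f ℤ.+ ∑ xs g
∑-+ []       f g = refl
∑-+ (x ∷ xs) f g = trans (cong (λ s → f x ℤ.+ g x ℤ.+ s) (∑-+ xs f g)) (interchange (f x) (g x) (∑ xs f) (∑ xs g))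
  where
  interchange : ∀ a b c d → a ℤ.+ b ℤ.+ (c ℤ.+ d) ≡ a ℤ.+ c ℤ.+ (b ℤ.+ d)
  interchange = solve-∀

∑-*ˡ : ∀ (xs : List A) c (f : A → ℤ) → ∑ xs (λ x → c ℤ.* f x) ≡ c ℤ.* ∑ xs f
∑-*ˡ []       c f = sym (ℤ.*-zeroʳ c)
∑-*ˡ (x ∷ xs) c f = trans (cong (λ s → c ℤ.* f x ℤ.+ s) (∑-*ˡ xs c f)) (sym (ℤ.*-distribˡ-+ c _ _))

∑-const : ∀ (xs : List A) c → ∑ xs (const c) ≡ + length xs ℤ.* c
∑-const []       c = refl
∑-const (x ∷ xs) c = trans (cong (λ s → c ℤ.+ s) (∑-const xs c)) (sym (ℤ.suc-* (+ length xs) c))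

∑-swap : ∀ (xs : List A) (ys : List B) (h : A → B → ℤ) →
         ∑ xs (λ x → ∑ ys (h x)) ≡ ∑ ys (λ y → ∑ xs (λ x → h x y))
∑-swap []       ys h = sym (trans (∑-const ys 0ℤ) (ℤ.*-zeroʳ (+ length ys)))
∑-swap (x ∷ xs) ys h = trans (cong (λ s → ∑ ys (h x) ℤ.+ s) (∑-swap xs ys h)) (sym (∑-+ ys (h x) _))

∑-filter : ∀ {P : Pred A 0ℓ} (P? : Decidable P) (xs : List A) (f : A → ℤ) →
           ∑ (filter P? xs) f ≡ ∑ xs (λ x → if does (P? x) then f x else 0ℤ)
∑-filter P? []       f = refl
∑-filter P? (x ∷ xs) f with does (P? x)
... | true  = cong (λ s → f x ℤ.+ s) (∑-filter P? xs f)
... | false = trans (∑-filter P? xs f) (sym (ℤ.+-identityˡ _))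

-- The witness `m` counts the entries signed `⊖`: each of them lowers the sum by 2 from its value
-- `length xs` for the all-`⊕` signing.
∑-signs-parity : ∀ (xs : List A) (f : A → Sign) →
                 ∃ λ m → ∑ xs (⟦_⟧ ∘ f) ℤ.+ + (m ℕ.* 2) ≡ + length xs
∑-signs-parity []       f = 0 , refl
∑-signs-parity (x ∷ xs) f with f x | ∑-signs-parity xs f
... | ⊕ | m , eq = m , trans (ℤ.+-assoc 1ℤ (∑ xs (⟦_⟧ ∘ f)) (+ (m ℕ.* 2))) (cong (λ s → 1ℤ ℤ.+ s) eq)
... | ⊖ | m , eq = suc m , trans (regroup (∑ xs (⟦_⟧ ∘ f)) (+ (m ℕ.* 2))) (cong (λ s → 1ℤ ℤ.+ s) eq)
  where
  regroup : ∀ a b → -1ℤ ℤ.+ a ℤ.+ (+ 2 ℤ.+ b) ≡ 1ℤ ℤ.+ (a ℤ.+ b)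
  regroup = solve-∀

I≡1 : ∀ {k n} → n % 2 ≡ k % 2 → I k n ≡ 1
I≡1 {k} {n} eq = cong (if_then 1 else 0) (dec-true (n % 2 ℕ.≟ k % 2) eq)

-- Either the sum exceeds `k`, which already gains the extra 1, or it equals `k`. In the second case
-- the sum has the parity of `length xs`, so the indicator is 1 and supplies the gain.
suc-k≤∑-signs+I : ∀ k (xs : List A) (f : A → Sign) → + k ℤ.≤ ∑ xs (⟦_⟧ ∘ f) →
                  + suc k ℤ.≤ ∑ xs (⟦_⟧ ∘ f) ℤ.+ + I k (length xs)
suc-k≤∑-signs+I k xs f k≤S with + k ℤ.≟ ∑ xs (⟦_⟧ ∘ f)
... | no k≢S = ℤ.≤-trans (ℤ.i<j⇒suc[i]≤j (ℤ.≤∧≢⇒< k≤S k≢S)) (ℤ.i≤i+j _ _)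
... | yes k≡S with ∑-signs-parity xs f
...   | m , S+2m≡d = ℤ.≤-reflexive (trans (cong +_ (ℕ.+-comm 1 k))
                                          (cong₂ (λ s i → s ℤ.+ + i) k≡S (sym (I≡1 {k} {length xs} d%2≡k%2))))
  where
  d%2≡k%2 : length xs % 2 ≡ k % 2
  -- With the sum equal to `k`, the parity lemma reads `k + 2m = length xs`, and reduction mod 2
  -- drops `2m`.
  d%2≡k%2 = trans (cong (_% 2) (sym (ℤ.+-injective (trans (cong (λ s → s ℤ.+ + (m ℕ.* 2)) k≡S) S+2m≡d))))
                  ([m+kn]%n≡m%n k m 2)

-- A gap of at least 1 absorbs an indicator at any argument `i`. This settles the strict case of
-- both monotonicity lemmas below, whose equality case is trivial.
<⇒+I≤+ : ∀ k {m n} i j → m ℕ.< n → m ℕ.+ I k i ≤ n ℕ.+ j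
<⇒+I≤+ k {m} {n} i j m<n = begin
  m ℕ.+ I k i  ≤⟨ ℕ.+-monoʳ-≤ m (I≤1 k i) ⟩
  m ℕ.+ 1      ≡⟨ ℕ.+-comm m 1 ⟩
  suc m        ≤⟨ m<n ⟩
  n            ≤⟨ ℕ.m≤m+n n j ⟩
  n ℕ.+ j      ∎
  where open ℕ.≤-Reasoning

+I-mono-≤ : ∀ k {m n} → m ≤ n → m ℕ.+ I k m ≤ n ℕ.+ I k n
+I-mono-≤ k {m} {n} m≤n with ℕ.m≤n⇒m<n∨m≡n m≤n
... | inj₁ m<n  = <⇒+I≤+ k m (I k n) m<n
... | inj₂ refl = ℕ.≤-refl

-- This is monotonicity of `n - I k n`, rearranged to avoid subtraction in ℕ. It serves the vertices
-- signed `⊖`, as monotonicity of `n + I k n` serves those signed `⊕`.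
+I-swap-≤ : ∀ k {m n} → m ≤ n → m ℕ.+ I k n ≤ n ℕ.+ I k m
+I-swap-≤ k {m} {n} m≤n with ℕ.m≤n⇒m<n∨m≡n m≤n
... | inj₁ m<n  = <⇒+I≤+ k n (I k m) m<n
... | inj₂ refl = ℕ.≤-refl

double-counting : ∀ (G : Graph) (g : Graph.Vertex G → ℤ) → let open Graph G in
                  ∑ vertices (λ v → ∑ (N v) g) ≡ ∑ vertices (λ v → + degree v ℤ.* g v)
double-counting G g = begin
  ∑ V (λ v → ∑ (N v) g)                          ≡⟨ ∑-cong V (λ v → ∑-filter (v ~?_) V g) ⟩
  ∑ V (λ v → ∑ V (λ u → [ does (v ~? u) ] g u))  ≡⟨ ∑-swap V V _ ⟩
  -- Symmetry of adjacency makes the inner sum over `v` run over `N u`, where the summand `g u` is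
  -- constant.
  ∑ V (λ u → ∑ V (λ v → [ does (v ~? u) ] g u))  ≡⟨ ∑-cong V (λ u → ∑-cong V (λ v →
                                                      cong ([_] g u) (does-sym v u))) ⟩
  ∑ V (λ u → ∑ V (λ v → [ does (u ~? v) ] g u))  ≡⟨ ∑-cong V (λ u → ∑-filter (u ~?_) V _) ⟨
  ∑ V (λ u → ∑ (N u) (const (g u)))              ≡⟨ ∑-cong V (λ u → ∑-const (N u) (g u)) ⟩
  ∑ V (λ u → + degree u ℤ.* g u)                 ∎
  where
  open ≡-Reasoning
  open Graph G renaming (vertices to V)
  [_]_ : Bool → ℤ → ℤ
  [ b ] x = if b then x else 0ℤ
  does-sym : ∀ v u → does (v ~? u) ≡ does (u ~? v)
  does-sym v u = does-⇔ (mk⇔ ~-sym ~-sym) (v ~? u) (u ~? v)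

+denominator : ∀ {k} → 1 ≤ k → ∀ G → k ≤ δ G →
               + denominator k G ≡ + δ G ℤ.+ + Δ G ℤ.+ + I k (Δ G) ℤ.- + I k (δ G)
+denominator {k} 1≤k G k≤δ = sym (trans (ℤ.m-n≡m⊖n _ (I k (δ G))) (ℤ.⊖-≥ (begin
  I k (δ G)                  ≤⟨ I≤1 k (δ G) ⟩
  1                          ≤⟨ ℕ.≤-trans 1≤k k≤δ ⟩
  δ G                        ≤⟨ ℕ.m≤m+n _ _ ⟩
  δ G ℕ.+ Δ G                ≤⟨ ℕ.m≤m+n _ _ ⟩
  δ G ℕ.+ Δ G ℕ.+ I k (Δ G)  ∎)))
  where open ℕ.≤-Reasoning

+-cancelˡ-≤ : ∀ a {b c} → a ℤ.+ b ℤ.≤ a ℤ.+ c → b ℤ.≤ c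
+-cancelˡ-≤ a {b} {c} le = ℤ.0≤i-j⇒j≤i (subst (0ℤ ℤ.≤_) (cancel a b c) (ℤ.i≤j⇒0≤j-i le))
  where
  cancel : ∀ a b c → a ℤ.+ c ℤ.- (a ℤ.+ b) ≡ c ℤ.- b
  cancel = solve-∀

-- Exhibiting `y - x` as twice a sum of two nonnegative slacks leaves only a ring identity for the
-- solver.
≤-by-difference : ∀ {a b c d x y} → a ℤ.≤ b → c ℤ.≤ d →
                  y ℤ.- x ≡ + 2 ℤ.* ((b ℤ.- a) ℤ.+ (d ℤ.- c)) → x ℤ.≤ y
≤-by-difference a≤b c≤d eq = ℤ.0≤i-j⇒j≤i (subst (0ℤ ℤ.≤_) (sym eq)
  (ℤ.*-monoˡ-≤-nonNeg (+ 2) (ℤ.+-mono-≤ (ℤ.i≤j⇒0≤j-i a≤b) (ℤ.i≤j⇒0≤j-i c≤d))))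

-- Let `p` be the parenthesis on the left and `q` the one on the right. Then
-- `p - q = 2(k + 1 - Δ - iΔ)` and `p + q = 2(k + 1 + δ - iδ)`. The case `⊕` asks for
-- `p - q ≤ 2(S - d)`, which follows from the upper bound on `d + i`; the case `⊖` asks for
-- `p + q ≤ 2(S + d)`, which follows from the lower bound on `d - i`.
sign-bound : ∀ s {k S d i δ Δ iδ iΔ} →
  1ℤ ℤ.+ k ℤ.≤ S ℤ.+ i → d ℤ.+ i ℤ.≤ Δ ℤ.+ iΔ → δ ℤ.+ i ℤ.≤ d ℤ.+ iδ →
  + 2 ℤ.* (d ℤ.* ⟦ s ⟧) ℤ.+ (δ ℤ.- Δ ℤ.+ + 2 ℤ.* k ℤ.+ + 2 ℤ.- iδ ℤ.- iΔ)
    ℤ.≤ + 2 ℤ.* S ℤ.+ (δ ℤ.+ Δ ℤ.+ iΔ ℤ.- iδ) ℤ.* ⟦ s ⟧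
sign-bound ⊕ {k} {S} {d} {i} {δ} {Δ} {iδ} {iΔ} 1+k≤S+i d+i≤Δ+iΔ _ =
  ≤-by-difference 1+k≤S+i d+i≤Δ+iΔ (identity k S d i δ Δ iδ iΔ)
  where
  identity : ∀ k S d i δ Δ iδ iΔ →
    + 2 ℤ.* S ℤ.+ (δ ℤ.+ Δ ℤ.+ iΔ ℤ.- iδ) ℤ.* 1ℤ
      ℤ.- (+ 2 ℤ.* (d ℤ.* 1ℤ) ℤ.+ (δ ℤ.- Δ ℤ.+ + 2 ℤ.* k ℤ.+ + 2 ℤ.- iδ ℤ.- iΔ))
    ≡ + 2 ℤ.* ((S ℤ.+ i ℤ.- (1ℤ ℤ.+ k)) ℤ.+ (Δ ℤ.+ iΔ ℤ.- (d ℤ.+ i)))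
  identity = solve-∀
sign-bound ⊖ {k} {S} {d} {i} {δ} {Δ} {iδ} {iΔ} 1+k≤S+i _ δ+i≤d+iδ =
  ≤-by-difference 1+k≤S+i δ+i≤d+iδ (identity k S d i δ Δ iδ iΔ)
  where
  identity : ∀ k S d i δ Δ iδ iΔ →
    + 2 ℤ.* S ℤ.+ (δ ℤ.+ Δ ℤ.+ iΔ ℤ.- iδ) ℤ.* -1ℤ
      ℤ.- (+ 2 ℤ.* (d ℤ.* -1ℤ) ℤ.+ (δ ℤ.- Δ ℤ.+ + 2 ℤ.* k ℤ.+ + 2 ℤ.- iδ ℤ.- iΔ))
    ≡ + 2 ℤ.* ((S ℤ.+ i ℤ.- (1ℤ ℤ.+ k)) ℤ.+ (d ℤ.+ iδ ℤ.- (δ ℤ.+ i)))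
  identity = solve-∀

module _ {k : ℕ} (1≤k : 1 ≤ k) (G : Graph) (k≤δ : k ≤ δ G) where
  open Graph G hiding (order; δ; Δ; δ≤Δ)

  private
    n p q : ℤ
    n = + order G
    p = numerator k G
    q = + denominator k G

  vertex-bound : ∀ {f} → SignedTotalDominating k G f → ∀ v →
                 + 2 ℤ.* (+ degree v ℤ.* ⟦ f v ⟧) ℤ.+ p ℤ.≤ + 2 ℤ.* ∑ (N v) (⟦_⟧ ∘ f) ℤ.+ q ℤ.* ⟦ f v ⟧
  vertex-bound {f} dom v =
    subst (λ x → + 2 ℤ.* (+ degree v ℤ.* ⟦ f v ⟧) ℤ.+ p ℤ.≤ + 2 ℤ.* ∑ (N v) (⟦_⟧ ∘ f) ℤ.+ x ℤ.* ⟦ f v ⟧)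
      -- `q` is the cast of a truncated subtraction, whereas `sign-bound` needs the integer
      -- expression.
      (sym (+denominator 1≤k G k≤δ))
      (sign-bound (f v) {k = + k} {S = ∑ (N v) (⟦_⟧ ∘ f)} {d = + degree v} {i = + I k (degree v)} {δ = + δ G} {Δ = + Δ G}
                        {iδ = + I k (δ G)} {iΔ = + I k (Δ G)}
        (suc-k≤∑-signs+I k (N v) f (dom v))
        (ℤ.+≤+ (+I-mono-≤ k (Δ-greatest v)))
        (ℤ.+≤+ (+I-swap-≤ k (δ-least v))))

  weight-bound : ∀ {f} → SignedTotalDominating k G f → n ℤ.* p ℤ.≤ weight G f ℤ.* q
  -- The degree-weighted sum `D` arises on the left from the vertex bounds and on the right from
  -- double counting, so `2 D` cancels.
  weight-bound {f} dom = ℤ.≤-trans (+-cancelˡ-≤ (+ 2 ℤ.* D) (begin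
    + 2 ℤ.* D ℤ.+ n ℤ.* p
      ≡⟨ cong₂ ℤ._+_ (∑-*ˡ V (+ 2) _) ∑p≡np ⟨
    ∑ V (λ v → + 2 ℤ.* (+ degree v ℤ.* σ v)) ℤ.+ ∑ V (const p)
      ≡⟨ ∑-+ V _ _ ⟨
    ∑ V (λ v → + 2 ℤ.* (+ degree v ℤ.* σ v) ℤ.+ p)
      ≤⟨ ∑-mono-≤ V (vertex-bound dom) ⟩
    ∑ V (λ v → + 2 ℤ.* ∑ (N v) σ ℤ.+ q ℤ.* σ v)
      ≡⟨ ∑-+ V _ _ ⟩
    ∑ V (λ v → + 2 ℤ.* ∑ (N v) σ) ℤ.+ ∑ V (λ v → q ℤ.* σ v)
      ≡⟨ cong₂ ℤ._+_ (∑-*ˡ V (+ 2) _) (∑-*ˡ V q σ) ⟩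
    + 2 ℤ.* ∑ V (λ v → ∑ (N v) σ) ℤ.+ q ℤ.* weight G f
      ≡⟨ cong (λ s → + 2 ℤ.* s ℤ.+ q ℤ.* weight G f) (double-counting G σ) ⟩
    + 2 ℤ.* D ℤ.+ q ℤ.* weight G f ∎)) (ℤ.≤-reflexive (ℤ.*-comm q _))
    where
    open ℤ.≤-Reasoning
    V = vertices
    σ : Vertex → ℤ
    σ = ⟦_⟧ ∘ f
    D = ∑ V (λ v → + degree v ℤ.* σ v)
    ∑p≡np : ∑ V (const p) ≡ n ℤ.* p
    ∑p≡np = trans (∑-const V p) (cong (λ m → + m ℤ.* p) (length-tabulate {n = order G} id))

-- The comparison passes to unnormalised rationals, where no reduction to lowest terms interferes
-- and the order is cross-multiplication.
*-/-≤ : ∀ n p w q .{{_ : NonZero q}} → n ℤ.* p ℤ.≤ w ℤ.* + q → (n / 1) * (p / q) ℚ.≤ w / 1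
*-/-≤ n p w q@(suc q-1) np≤wq = ℚ.toℚᵘ-cancel-≤ (begin
  ℚ.toℚᵘ ((n / 1) * (p / q))                ≃⟨ ℚ.toℚᵘ-homo-* (n / 1) (p / q) ⟩
  ℚ.toℚᵘ (n / 1) ℚᵘ.* ℚ.toℚᵘ (p / q)        ≃⟨ ℚᵘ.*-cong (ℚ.toℚᵘ-fromℚᵘ (ℚᵘ.mkℚᵘ n 0))
                                                        (ℚ.toℚᵘ-fromℚᵘ (ℚᵘ.mkℚᵘ p q-1)) ⟩
  -- Cross-multiplying asks for `n p * 1 ≤ w * (1 * q)`, and `1 * q` computes to `q + 0`.
  ℚᵘ.mkℚᵘ n 0 ℚᵘ.* ℚᵘ.mkℚᵘ p q-1            ≤⟨ ℚᵘ.*≤* (subst₂ ℤ._≤_ (sym (ℤ.*-identityʳ (n ℤ.* p)))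
                                                  (cong (λ d → w ℤ.* + d) (sym (ℕ.+-identityʳ q))) np≤wq) ⟩
  ℚᵘ.mkℚᵘ w 0                               ≃⟨ ℚ.toℚᵘ-fromℚᵘ (ℚᵘ.mkℚᵘ w 0) ⟨
  ℚ.toℚᵘ (w / 1)                            ∎)
  where open ℚᵘ.≤-Reasoning

theorem6 : (k : ℕ) (1≤k : 1 ≤ k) (G : Graph) (k≤δ : k ≤ δ G) →
    γᵗₛ k G / 1 ≥ (+ order G / 1) * (_/_ (numerator k G) (denominator k G) {{denominator≢0 1≤k G k≤δ}})
theorem6 k 1≤k G k≤δ with γᵗₛ-attained k G k≤δ
... | f , dom , γ≡w = *-/-≤ (+ order G) (numerator k G) (γᵗₛ k G) (denominator k G)
  {{denominator≢0 1≤k G k≤δ}}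
  (subst (λ w → + order G ℤ.* numerator k G ℤ.≤ w ℤ.* + denominator k G) (sym γ≡w)
         (weight-bound 1≤k G k≤δ dom))
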